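{- Let $K=\mathbb{F}_q$ be a finite field. Let $\mathcal{G}$ be a bipartite simple graph with a perfect matching, labelled as in the context, let $\mathbb{X}\subseteq\mathbb{P}^{s-1}$ be the toric set parameterized by its edges, let $\mathbb{Y}\subseteq\mathbb{X}$ be the set defined in the context, and let $\theta:S\to R$ be the $K$-algebra map defined in the context. Then $$I_{\mathbb{Y}}=I_{\mathbb{X}}+\ker\theta.$$
   Context: Setting: $\mathcal{G}$ is a bipartite simple graph on vertices $v_1,\ldots,v_{2k}$ with $s$ edges, every edge joining a vertex of $\{v_1,v_3,\ldots,v_{2k-1}\}$ to a vertex of $\{v_2,v_4,\ldots,v_{2k}\}$, and $\{\{v_{2i-1},v_{2i}\}: i=1,\ldots,k\}$ is a perfect matching of $\mathcal{G}$. Let $n_i=\deg v_i$, so $n_1+n_3+\cdots+n_{2k-1}=s$. The edges are ordered in consecutive blocks: first the $n_1$ edges incident with $v_1$ (starting with $\{v_1,v_2\}$), then the $n_3$ edges incident with $v_3$ (starting with $\{v_3,v_4\}$), and so on, finally the $n_{2k-1}$ edges incident with $v_{2k-1}$ (starting with $\{v_{2k-1},v_{2k}\}$). With $K^*=K\setminus\{0\}$, the toric set parameterized by the edges is the set $\mathbb{X}\subseteq\mathbb{P}^{s-1}$ of all points, for $(t_1,\ldots,t_{2k})\in(K^*)^{2k}$, whose coordinate at the edge $\{v_j,v_l\}$ is $t_jt_l$ (coordinates ordered as the edges are: first the $n_1$ edges incident with $v_1$, then the $n_3$ edges incident with $v_3$, and so on, finally the $n_{2k-1}$ edges incident with $v_{2k-1}$,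 the block of $v_{2i-1}$ starting with the edge $\{v_{2i-1},v_{2i}\}$). Further $$\mathbb{Y}=\{[t_1,\ldots,t_1,t_3,\ldots,t_3,\ldots,t_{2k-1},\ldots,t_{2k-1}]\in\mathbb{P}^{s-1}: t_i\in K^*\},$$ where $t_i$ appears $n_i$ times for $i=1,3,\ldots,2k-1$. $S=K[X_1,\ldots,X_s]$ and $R=K[Y_1,Y_3,\ldots,Y_{2k-1}]$ are polynomial rings, and $\theta:S\to R$ is given by $f(X_1,\ldots,X_s)\mapsto f(Y_1,\ldots,Y_1,Y_3,\ldots,Y_3,\ldots,Y_{2k-1},\ldots,Y_{2k-1})$, where $Y_i$ appears $n_i$ times for $i=1,3,\ldots,2k-1$. The vanishing ideal $I_{\mathbb{Z}}\subseteq S$ of a set $\mathbb{Z}\subseteq\mathbb{P}^{s-1}$ is the ideal generated by the homogeneous polynomials vanishing at all points of $\mathbb{Z}$. -}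

module Defs where

open import Algebra.Bundles using (CommutativeRing; RawRing)
import Algebra.Definitions.RawSemiring as RawSemiringDefinitions
open import Data.Bool.Base using (if_then_else_)
open import Data.Fin.Base using (Fin; zero; suc; toℕ; splitAt; combine)
open import Data.Fin.Subset using (Subset; _∈_; _∉_; ∣_∣)
open import Data.List.Base as List using (List; []; _∷_; _++_)
open import Data.Nat.Base as ℕ using (ℕ; zero; suc)
import Data.Nat.Properties as ℕ
open import Data.Product.Base as Product using (Σ; ∃; ∃₂; ∃-syntax; _×_; _,_; proj₁; proj₂)
open import Data.Product using (∃!)
open import Data.Sum.Base using (_⊎_; [_,_]′)
open import Data.Vec.Base as Vec using (Vec)
open import Data.Vec.Functional as Vector using (Vector)
import Data.Vec.Properties as Vec
open import Function.Base using (_∘_; id)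
open import Function.Bundles using (Inverse)
open import Function.Definitions using (Injective)
open import Level using (Level; _⊔_) renaming (suc to lsuc)
open import Relation.Binary.PropositionalEquality as ≡ using (_≡_)
open import Relation.Nullary.Decidable.Core using (does)
open import Relation.Unary using (Pred)

record FiniteField (c ℓ : Level) : Set (lsuc (c ⊔ ℓ)) where
  field
    commutativeRing : CommutativeRing c ℓ
  open CommutativeRing commutativeRing public
  field
    1≉0     : 1# ≉ 0#
    inverse : ∀ x → x ≉ 0# → ∃[ y ] x * y ≈ 1#
    q       : ℕ
    finite  : Inverse setoid (≡.setoid (Fin q))

module Ideals {a ℓ} (A : RawRing a ℓ) where
  open RawRing A

  data ⟨_⟩ {g} (G : Pred Carrier g) : Pred Carrier (a ⊔ ℓ ⊔ g) where
    gen  : ∀ {x} → G x → ⟨ G ⟩ x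
    zero : ⟨ G ⟩ 0#
    add  : ∀ {x y} → ⟨ G ⟩ x → ⟨ G ⟩ y → ⟨ G ⟩ (x + y)
    mul  : ∀ r {x} → ⟨ G ⟩ x → ⟨ G ⟩ (r * x)
    resp : ∀ {x y} → x ≈ y → ⟨ G ⟩ x → ⟨ G ⟩ y

  infixl 6 _⊕_
  _⊕_ : ∀ {i j} → Pred Carrier i → Pred Carrier j → Pred Carrier (a ⊔ ℓ ⊔ i ⊔ j)
  (I ⊕ J) f = ∃₂ λ x y → I x × J y × f ≈ x + y

module Polynomials {c ℓ} (K : CommutativeRing c ℓ) where
  open CommutativeRing K

  -- A polynomial in n variables is a formal sum of terms a · X^m, given as
  -- a list of pairs (a , m).  The same monomial may occur several times, and
  -- coefficients may be zero; equality is equality of all coefficients.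
  Poly : ℕ → Set c
  Poly n = List (Carrier × Vec ℕ n)

  coeff : ∀ {n} → Poly n → Vec ℕ n → Carrier
  coeff []             m = 0#
  coeff ((a , m′) ∷ p) m =
    (if does (Vec.≡-dec ℕ._≟_ m′ m) then a else 0#) + coeff p m

  infix 4 _≈ₚ_
  _≈ₚ_ : ∀ {n} → Poly n → Poly n → Set ℓ
  p ≈ₚ r = ∀ m → coeff p m ≈ coeff r m

  const : ∀ {n} → Carrier → Poly n
  const a = (a , Vec.replicate _ 0) ∷ []

  var : ∀ {n} → Fin n → Poly n
  var i = (1# , Vec.replicate _ 0 Vec.[ i ]≔ 1) ∷ []

  mulTerm : ∀ {n} → Carrier × Vec ℕ n → Carrier × Vec ℕ n → Carrier × Vec ℕ n
  mulTerm (a , m) (b , m′) = a * b , Vec.zipWith ℕ._+_ m m′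

  polyRing : ℕ → RawRing c ℓ
  polyRing n = record
    { Carrier = Poly n
    ; _≈_     = _≈ₚ_
    ; _+_     = _++_
    ; _*_     = List.cartesianProductWith mulTerm
    ; -_      = List.map (Product.map₁ (-_))
    ; 0#      = []
    ; 1#      = const 1#
    }

  -- f(x₁,…,xₙ) for elements xᵢ of a K-algebra A with structure map ι.
  module _ {a ℓ′} (A : RawRing a ℓ′) (ι : Carrier → RawRing.Carrier A) where
    private module A = RawRing A
    open RawSemiringDefinitions A.rawSemiring using (_^_; product)

    substitute : ∀ {n} → Vector A.Carrier n → Poly n → A.Carrier
    substitute x []            = A.0#
    substitute x ((b , m) ∷ p) =
      (ι b A.* product (λ i → x i ^ Vec.lookup m i)) A.+ substitute x p

  eval : ∀ {n} → Vector Carrier n → Poly n → Carrier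
  eval = substitute rawRing id

  IsHomogeneous : ∀ {n} → Poly n → Set ℓ
  IsHomogeneous f = ∃[ d ] (∀ m → coeff f m ≉ 0# → Vec.sum m ≡ d)

module Projective {c ℓ} (K : CommutativeRing c ℓ) where
  open CommutativeRing K
  open Polynomials K

  -- A representative of a point of the projective space with n homogeneous
  -- coordinates, i.e. of dimension n - 1.
  record Point (n : ℕ) : Set (c ⊔ ℓ) where
    field
      coords  : Vector Carrier n
      nonzero : ∃[ e ] coords e ≉ 0#

  infix 4 _∼_
  _∼_ : ∀ {n} → Vector Carrier n → Vector Carrier n → Set (c ⊔ ℓ)
  x ∼ y = ∃[ u ] (u ≉ 0# × ∀ e → x e ≈ u * y e)

  -- For homogeneous f, vanishing does not depend on the representative.
  VanishesOn : ∀ {n z} → Poly n → Pred (Point n) z → Set (c ⊔ ℓ ⊔ z)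
  VanishesOn f Z = ∀ P → Z P → eval (Point.coords P) f ≈ 0#

  VanishingIdeal : ∀ {n z} → Pred (Point n) z → Pred (Poly n) (c ⊔ ℓ ⊔ z)
  VanishingIdeal {n} Z = ⟨ (λ f → IsHomogeneous f × VanishesOn f Z) ⟩
    where open Ideals (polyRing n)

record SimpleGraph (n : ℕ) : Set where
  field
    neighbours : Fin n → Subset n
  Adj : Fin n → Fin n → Set
  Adj u v = v ∈ neighbours u
  field
    symmetric   : ∀ {u v} → Adj u v → Adj v u
    irreflexive : ∀ v → v ∉ neighbours v

  degree : Fin n → ℕ
  degree v = ∣ neighbours v ∣

  IsPerfectMatching : ∀ {k} → (Fin k → Fin n × Fin n) → Set
  IsPerfectMatching M =
      (∀ i → Adj (proj₁ (M i)) (proj₂ (M i)))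
    × (∀ v → ∃! _≡_ λ i → v ≡ proj₁ (M i) ⊎ v ≡ proj₂ (M i))

-- With i counted from 1, odd i is v₂ᵢ₋₁ and even i is v₂ᵢ: as elements of
-- Fin (k * 2), whose entries count from 0, they are 2(i-1) and 2(i-1)+1.
odd even : ∀ {k} → Fin k → Fin (k ℕ.* 2)
odd  i = combine i zero
even i = combine i (suc zero)

sum : ∀ {k} → Vector ℕ k → ℕ
sum = Vector.foldr ℕ._+_ 0

-- Splits a position in a row of consecutive blocks of lengths n₁, …, nₖ
-- into the block containing it and the position inside that block.
locate : ∀ {k} (n : Vector ℕ k) → Fin (sum n) → Σ (Fin k) (Fin ∘ n)
locate {suc k} n e =
  [ (λ j → zero , j)
  , (λ e′ → Product.map suc id (locate (Vector.tail n) e′))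
  ]′ (splitAt (n zero) e)

record LabelledGraph (k : ℕ) : Set where
  field
    graph : SimpleGraph (k ℕ.* 2)
  open SimpleGraph graph public
  field
    bipartite : ∀ {u v} → Adj u v →
                  (∃₂ λ (i j : Fin k) → u ≡ odd i × v ≡ even j)
                ⊎ (∃₂ λ (i j : Fin k) → u ≡ even i × v ≡ odd j)
    matching  : IsPerfectMatching {k} (λ i → odd i , even i)

    -- The order of the edges at v₂ᵢ₋₁: the j-th one joins it to nbr i j.
    nbr            : (i : Fin k) → Fin (degree (odd i)) → Fin (k ℕ.* 2)
    nbr-adjacent   : ∀ i j → Adj (odd i) (nbr i j)
    nbr-injective  : ∀ i → Injective _≡_ _≡_ (nbr i)
    nbr-surjective : ∀ i {v} → Adj (odd i) v → ∃[ j ] nbr i j ≡ v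
    nbr-first      : ∀ i j → toℕ j ≡ 0 → nbr i j ≡ even i

  oddDegree : Vector ℕ k
  oddDegree i = degree (odd i)

  -- The number of edges: each edge has exactly one odd endpoint.
  s : ℕ
  s = sum oddDegree

  block : Fin s → Fin k
  block e = proj₁ (locate oddDegree e)

  edge : Fin s → Fin (k ℕ.* 2) × Fin (k ℕ.* 2)
  edge e = let (i , j) = locate oddDegree e in odd i , nbr i j

module Toric {c ℓ} (K : CommutativeRing c ℓ) {k : ℕ} (𝒢 : LabelledGraph k) where
  open CommutativeRing K
  open Polynomials K
  open Projective K
  open LabelledGraph 𝒢

  𝕏 : Pred (Point s) (c ⊔ ℓ)
  𝕏 P = Σ (Vector Carrier (k ℕ.* 2)) λ t →
          (∀ v → t v ≉ 0#)
        × Point.coords P ∼ λ e → t (proj₁ (edge e)) * t (proj₂ (edge e))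

  𝕐 : Pred (Point s) (c ⊔ ℓ)
  𝕐 P = Σ (Vector Carrier k) λ t →
          (∀ i → t i ≉ 0#)
        × Point.coords P ∼ λ e → t (block e)

  -- The variable of R indexed by i : Fin k is Y₂ᵢ₋₁ (i counted from 1).
  θ : Poly s → Poly k
  θ = substitute (polyRing k) const (λ e → var (block e))

  kerθ : Pred (Poly s) ℓ
  kerθ f = θ f ≈ₚ []

{-# OPTIONS --safe #-}

-- The edge {v₂ᵢ₋₁, v₂ᵢ} lies in the i-th block, so sending Y₂ᵢ₋₁ to its variable
-- is a section σ of θ.  At a point of 𝕏 with parameters t, the form σ(θ f) takes
-- the value of f at the point of 𝕐 with parameters t₂ᵢ₋₁ t₂ᵢ; hence σ ∘ θ maps
-- I_𝕐 into I_𝕏, and f = σ(θ f) + (f - σ(θ f)) is the required decomposition.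
-- Conversely 𝕐 ⊆ 𝕏 (put t₂ᵢ = 1), and ker θ is graded and vanishes on 𝕐.

module Submission where

open import Algebra.Bundles using (CommutativeMonoid; CommutativeRing; RawRing)
import Algebra.Definitions.RawSemiring as RawSemiringDefinitions
import Algebra.Properties.CommutativeMonoid.Mult as CommutativeMonoidMult
import Algebra.Properties.CommutativeMonoid.Sum as CommutativeMonoidSum
import Algebra.Properties.CommutativeSemigroup as CommutativeSemigroupProperties
import Algebra.Properties.Group as GroupProperties
import Algebra.Properties.Ring as RingProperties
open import Data.Bool.Base using (if_then_else_; true; false)
open import Data.Fin.Base using (Fin; zero; suc; _↑ˡ_; _↑ʳ_; remQuot)
import Data.Fin.Properties as Fin
open import Data.List.Base as List using (List; []; _∷_; _++_; length; filter)
import Data.List.Properties as List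
open import Data.List.Relation.Unary.Any using (here)
open import Data.Nat.Base as ℕ using (ℕ; NonZero)
open import Data.Nat.Induction using (<-wellFounded)
import Data.Nat.Properties as ℕ
open import Data.Product.Base as Product using (_,_; proj₁; proj₂; ∃-syntax)
open import Data.Sum.Base using (inj₁; inj₂)
open import Data.Vec.Base as Vec using (Vec; []; _∷_)
import Data.Vec.Properties as Vec
open import Data.Vec.Functional as Vector using (Vector)
open import Function.Base using (_∘_; _$_; _on_; const)
open import Function.Bundles using (_⇔_; mk⇔)
open import Function.Properties.Inverse using (Inverse⇒Injection)
open import Induction.WellFounded using (module All)
import Relation.Binary.Construct.On as On
open import Relation.Binary.Definitions using (DecidableEquality; Decidable)
open import Relation.Binary.PropositionalEquality as ≡ using (_≡_; refl; _≗_)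
import Relation.Binary.Reasoning.Setoid as SetoidReasoning
open import Relation.Nullary using (¬_; Dec; yes; no; does; ¬?; contradiction)
open import Relation.Nullary.Decidable using (via-injection; decidable-stable)
open import Relation.Unary using (Pred; _⊆_) renaming (Decidable to Decidable₁)

open import Defs

-- Exponent vectors and relabelling of variables.

-- The monomials Y^m with m : Vec ℕ n form the free commutative monoid on n
-- generators; extend x is the homomorphism sending the i-th one to x i.
module Extension {a ℓ} (M : CommutativeMonoid a ℓ) where
  open CommutativeMonoid M renaming (refl to ≈-refl)
  open CommutativeMonoidMult M
  open CommutativeMonoidSum M renaming (sum to ∑)

  extend : ∀ {n} → Vector Carrier n → Vec ℕ n → Carrier
  extend x m = ∑ (λ e → Vec.lookup m e × x e)

  extend-cong : ∀ {n} {x y : Vector Carrier n} → (∀ e → x e ≈ y e) →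
                ∀ m → extend x m ≈ extend y m
  extend-cong x≈y m = sum-cong-≋ (λ e → ×-congʳ (Vec.lookup m e) (x≈y e))

  extend-0 : ∀ {n} (x : Vector Carrier n) → extend x (Vec.replicate n 0) ≈ ε
  extend-0 {ℕ.zero}  x = ≈-refl
  extend-0 {ℕ.suc n} x = trans (identityˡ _) (extend-0 (x ∘ suc))

  extend-+ : ∀ {n} (x : Vector Carrier n) u v →
             extend x (Vec.zipWith ℕ._+_ u v) ≈ extend x u ∙ extend x v
  extend-+ x u v = trans
    (sum-cong-≋ λ e → trans
      (×-congˡ (Vec.lookup-zipWith ℕ._+_ e u v))
      (×-homo-+ (x e) (Vec.lookup u e) (Vec.lookup v e)))
    (∑-distrib-+ (λ e → Vec.lookup u e × x e) (λ e → Vec.lookup v e × x e))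

unit : ∀ {n} → Fin n → Vec ℕ n
unit i = Vec.replicate _ 0 Vec.[ i ]≔ 1

-- Packaged as a monoid so that `extend` also yields the homomorphisms between free commutative
-- monoids.
exponents : ℕ → CommutativeMonoid _ _
exponents n = record
  { Carrier = Vec ℕ n
  ; _≈_     = _≡_
  ; _∙_     = Vec.zipWith ℕ._+_
  ; ε       = Vec.replicate n 0
  ; isCommutativeMonoid = record
    { isMonoid = record
      { isSemigroup = record
        { isMagma = ≡.isMagma _
        ; assoc   = Vec.zipWith-assoc ℕ.+-assoc
        }
      ; identity = Vec.zipWith-identityˡ ℕ.+-identityˡ
                 , Vec.zipWith-identityʳ ℕ.+-identityʳ
      }
    ; comm = Vec.zipWith-comm ℕ.+-comm
    }
  }

module ExtensionProperties {a ℓ} (M : CommutativeMonoid a ℓ) where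
  open CommutativeMonoid M renaming (refl to ≈-refl)
  open CommutativeMonoidMult M
  open Extension M public
  private
    module E {n} = Extension (exponents n)
    module EM {n} = CommutativeMonoidMult (exponents n)

  extend-unit : ∀ {n} (x : Vector Carrier n) i → extend x (unit i) ≈ x i
  extend-unit x zero = trans (∙-congˡ (extend-0 (x ∘ suc)))
    (trans (identityʳ _) (identityʳ _))
  extend-unit x (suc i) = trans (identityˡ _) (extend-unit (x ∘ suc) i)

  extend-× : ∀ {n} (x : Vector Carrier n) r m →
             extend x (r EM.× m) ≈ r × extend x m
  extend-× x ℕ.zero    m = extend-0 x
  extend-× x (ℕ.suc r) m =
    trans (extend-+ x m (r EM.× m)) (∙-congˡ (extend-× x r m))

  -- `extend x` is a homomorphism, so it passes through the sums and multiples that make up the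
  -- inner extension. Functoriality of `push` and its compatibility with evaluation both come from
  -- here.
  extend-extend : ∀ {n p} (x : Vector Carrier n) (y : Vector (Vec ℕ n) p) m →
                  extend x (E.extend y m) ≈ extend (extend x ∘ y) m
  extend-extend x y []      = extend-0 x
  extend-extend x y (r ∷ m) = trans
    (extend-+ x (r EM.× y zero) (E.extend (y ∘ suc) m))
    (∙-cong (extend-× x r (y zero)) (extend-extend x (y ∘ suc) m))

-- The effect on exponents of the substitution sending the variable e to h e.
push : ∀ {n p} → (Fin p → Fin n) → Vec ℕ p → Vec ℕ n
push h = Extension.extend (exponents _) (unit ∘ h)

push-+ : ∀ {n p} (h : Fin p → Fin n) u v →
         push h (Vec.zipWith ℕ._+_ u v) ≡ Vec.zipWith ℕ._+_ (push h u) (push h v)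
push-+ h = Extension.extend-+ (exponents _) (unit ∘ h)

module _ {a ℓ} (M : CommutativeMonoid a ℓ) where
  open CommutativeMonoid M renaming (refl to ≈-refl)
  open ExtensionProperties M

  extend-push : ∀ {n p} (x : Vector Carrier n) (h : Fin p → Fin n) m →
                extend x (push h m) ≈ extend (x ∘ h) m
  extend-push x h m = trans (extend-extend x (unit ∘ h) m)
    (extend-cong (λ e → extend-unit x (h e)) m)

push-∘ : ∀ {n p r} (h : Fin p → Fin n) (g : Fin r → Fin p) m →
         push h (push g m) ≡ push (h ∘ g) m
push-∘ h = extend-push (exponents _) (unit ∘ h)

push-cong : ∀ {n p} {h g : Fin p → Fin n} → h ≗ g → push h ≗ push g
push-cong h≗g = Extension.extend-cong (exponents _) (λ e → ≡.cong unit (h≗g e))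

module _ where
  open Extension ℕ.+-0-commutativeMonoid

  sum≡extend : ∀ {n} (m : Vec ℕ n) → Vec.sum m ≡ extend (const 1) m
  sum≡extend []      = refl
  sum≡extend (r ∷ m) = ≡.cong₂ ℕ._+_ (r≡r×1 r) (sum≡extend m)
    where
    open CommutativeMonoidMult ℕ.+-0-commutativeMonoid using () renaming (_×_ to _·_)
    r≡r×1 : ∀ r → r ≡ r · 1
    r≡r×1 ℕ.zero    = refl
    r≡r×1 (ℕ.suc r) = ≡.cong ℕ.suc (r≡r×1 r)

  -- Total degree is the homomorphism with value 1 on every generator, a value that relabelling
  -- generators cannot change. Hence `θ` and its section are graded.
  sum-push : ∀ {n p} (h : Fin p → Fin n) m → Vec.sum (push h m) ≡ Vec.sum m
  sum-push h m = begin
    Vec.sum (push h m)           ≡⟨ sum≡extend (push h m) ⟩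
    extend (const 1) (push h m)  ≡⟨ extend-push ℕ.+-0-commutativeMonoid (const 1) h m ⟩
    extend (const 1) m           ≡⟨ sum≡extend m ⟨
    Vec.sum m                    ∎
    where open ≡.≡-Reasoning

-- Well-founded induction on length: the head fails the filter built from its own key, so the
-- filtered list is strictly shorter. With monomials as keys this collects like terms; with degrees
-- as keys it splits a polynomial into forms.
filter-induction : ∀ {a b q} {A : Set a} {B : Set b} (_≟_ : DecidableEquality B)
  (key : A → B) (Q : Pred (List A) q) → Q [] →
  (∀ x xs → Q (filter (λ y → ¬? (key y ≟ key x)) (x ∷ xs)) → Q (x ∷ xs)) →
  ∀ xs → Q xs
filter-induction _≟_ key Q Q[] step =
  wfRec Q λ where
    []       _   → Q[]
    (x ∷ xs) rec → step x xs
      (rec (List.filter-notAll (λ y → ¬? (key y ≟ key x)) (x ∷ xs) (here (_$ refl))))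
  where open All (On.wellFounded length <-wellFounded) _ using (wfRec)

-- Linear functionals on formal sums.

module PolynomialProperties {c ℓ} (K : CommutativeRing c ℓ) where
  open CommutativeRing K renaming (refl to ≈-refl)
  open Polynomials K renaming (const to constₚ)
  open SetoidReasoning setoid

  -- Coefficients, values at a point and coefficients after relabelling all have this shape for a
  -- suitable `W`, so additivity and invariance under `≈ₚ` are proved once for all of them.
  linear : ∀ {n} → (Vec ℕ n → Carrier) → Poly n → Carrier
  linear W []            = 0#
  linear W ((a , m) ∷ p) = a * W m + linear W p

  linear-cong : ∀ {n} {W V : Vec ℕ n → Carrier} → (∀ m → W m ≈ V m) →
                ∀ p → linear W p ≈ linear V p
  linear-cong W≈V []            = ≈-refl
  linear-cong W≈V ((a , m) ∷ p) = +-cong (*-congˡ (W≈V m)) (linear-cong W≈V p)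

  linear-++ : ∀ {n} (W : Vec ℕ n → Carrier) p r →
              linear W (p ++ r) ≈ linear W p + linear W r
  linear-++ W []            r = sym (+-identityˡ _)
  linear-++ W ((a , m) ∷ p) r =
    trans (+-congˡ (linear-++ W p r)) (sym (+-assoc _ _ _))

  linear-neg : ∀ {n} (W : Vec ℕ n → Carrier) p →
               linear W (List.map (Product.map₁ (-_)) p) ≈ - linear W p
  linear-neg W []            = sym -0#≈0#
    where open RingProperties ring
  linear-neg W ((a , m) ∷ p) = begin
    (- a) * W m + linear W (List.map (Product.map₁ (-_)) p)
      ≈⟨ +-cong (sym (-‿distribˡ-* a (W m))) (linear-neg W p) ⟩
    - (a * W m) + - linear W p
      ≈⟨ -‿+-comm (a * W m) (linear W p) ⟩
    - (a * W m + linear W p) ∎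
    where open RingProperties ring

  δ : ∀ {n} → Vec ℕ n → Vec ℕ n → Carrier
  δ m m′ = if does (Vec.≡-dec ℕ._≟_ m′ m) then 1# else 0#

  coeff≈linear : ∀ {n} (p : Poly n) m → coeff p m ≈ linear (δ m) p
  coeff≈linear []             m = ≈-refl
  coeff≈linear ((a , m′) ∷ p) m with Vec.≡-dec ℕ._≟_ m′ m
  ... | yes _ = +-cong (sym (*-identityʳ a)) (coeff≈linear p m)
  ... | no  _ = +-cong (sym (zeroʳ a)) (coeff≈linear p m)

  coeff-++ : ∀ {n} (p r : Poly n) m → coeff (p ++ r) m ≈ coeff p m + coeff r m
  coeff-++ p r m = begin
    coeff (p ++ r) m                   ≈⟨ coeff≈linear (p ++ r) m ⟩
    linear (δ m) (p ++ r)              ≈⟨ linear-++ (δ m) p r ⟩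
    linear (δ m) p + linear (δ m) r    ≈⟨ +-cong (coeff≈linear p m) (coeff≈linear r m) ⟨
    coeff p m + coeff r m              ∎

  coeff-neg : ∀ {n} (p : Poly n) m →
              coeff (List.map (Product.map₁ (-_)) p) m ≈ - coeff p m
  coeff-neg p m = begin
    coeff (List.map (Product.map₁ (-_)) p) m
      ≈⟨ coeff≈linear (List.map (Product.map₁ (-_)) p) m ⟩
    linear (δ m) (List.map (Product.map₁ (-_)) p)    ≈⟨ linear-neg (δ m) p ⟩
    - linear (δ m) p                                 ≈⟨ -‿cong (coeff≈linear p m) ⟨
    - coeff p m                                      ∎

  restrict : ∀ {n r} {P : Pred (Vec ℕ n) r} → Decidable₁ P → Poly n → Poly n
  restrict P? = filter (P? ∘ proj₂)

  coeff-restrict : ∀ {n r} {P : Pred (Vec ℕ n) r} (P? : Decidable₁ P) p m →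
                   coeff (restrict P? p) m ≈ (if does (P? m) then coeff p m else 0#)
  coeff-restrict P? []             m with P? m
  ... | yes _ = ≈-refl
  ... | no  _ = ≈-refl
  -- The equation `eq` is kept because a head that survives the filter brings this comparison back
  -- into the goal.
  coeff-restrict P? ((a , m′) ∷ p) m with Vec.≡-dec ℕ._≟_ m′ m in eq
  coeff-restrict P? ((a , m′) ∷ p) .m′ | yes refl
    with P? m′ | coeff-restrict P? p m′
  ... | no  _ | rec = rec
  ... | yes _ | rec rewrite eq = +-congˡ rec
  coeff-restrict P? ((a , m′) ∷ p) m   | no _
    with P? m′ | P? m | coeff-restrict P? p m
  ... | no  _ | no  _ | rec = rec
  ... | no  _ | yes _ | rec = trans rec (sym (+-identityˡ _))
  ... | yes _ | no  _ | rec rewrite eq = trans (+-identityˡ _) rec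
  ... | yes _ | yes _ | rec rewrite eq = +-congˡ rec

  linear-split : ∀ {n r} {P : Pred (Vec ℕ n) r} (P? : Decidable₁ P) W p →
    linear W p ≈ linear W (restrict P? p) + linear W (restrict (¬? ∘ P?) p)
  linear-split P? W []            = sym (+-identityˡ 0#)
  linear-split P? W ((a , m) ∷ p) with P? m
  ... | yes _ = trans (+-congˡ (linear-split P? W p)) (sym (+-assoc _ _ _))
  ... | no  _ = trans (+-congˡ (linear-split P? W p))
    (x∙yz≈y∙xz (a * W m) _ _)
    where open CommutativeSemigroupProperties +-commutativeSemigroup

  ≈ₚ-split : ∀ {n r} {P : Pred (Vec ℕ n) r} (P? : Decidable₁ P) p →
    p ≈ₚ restrict P? p ++ restrict (¬? ∘ P?) p
  ≈ₚ-split P? p m = begin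
    coeff p m                                                             ≈⟨ coeff≈linear p m ⟩
    linear (δ m) p                                                        ≈⟨ linear-split P? (δ m) p ⟩
    linear (δ m) (restrict P? p) + linear (δ m) (restrict (¬? ∘ P?) p)    ≈⟨ linear-++ (δ m) (restrict P? p) _ ⟨
    linear (δ m) (restrict P? p ++ restrict (¬? ∘ P?) p)                  ≈⟨ coeff≈linear (restrict P? p ++ _) m ⟨
    coeff (restrict P? p ++ restrict (¬? ∘ P?) p) m                       ∎

  linear-restrict-≡ : ∀ {n} W (p : Poly n) m →
    linear W (restrict (λ m′ → Vec.≡-dec ℕ._≟_ m′ m) p) ≈ coeff p m * W m
  linear-restrict-≡ W []             m = sym (zeroˡ _)
  linear-restrict-≡ W ((a , m′) ∷ p) m with Vec.≡-dec ℕ._≟_ m′ m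
  ... | yes refl = trans (+-congˡ (linear-restrict-≡ W p m)) (sym (distribʳ _ _ _))
  ... | no  _    = trans (linear-restrict-≡ W p m) (*-congʳ (sym (+-identityˡ _)))

  -- Grouping the terms of p by monomial turns linear W p into a sum of
  -- coeff p m * W m over distinct monomials m.
  linear-zero : ∀ {n} W (p : Poly n) → (∀ m → coeff p m * W m ≈ 0#) → linear W p ≈ 0#
  linear-zero {n} W = filter-induction _≟_ proj₂
      (λ p → (∀ m → coeff p m * W m ≈ 0#) → linear W p ≈ 0#) (λ _ → ≈-refl) step
    where
    _≟_ : DecidableEquality (Vec ℕ n)
    _≟_ = Vec.≡-dec ℕ._≟_
    step : ∀ t p →
      let r = restrict (λ m′ → ¬? (m′ ≟ proj₂ t)) (t ∷ p) in
      ((∀ m → coeff r m * W m ≈ 0#) → linear W r ≈ 0#) →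
      (∀ m → coeff (t ∷ p) m * W m ≈ 0#) → linear W (t ∷ p) ≈ 0#
    step t@(_ , m₀) p rec vanish = begin
      linear W (t ∷ p)
        ≈⟨ linear-split (_≟ m₀) W (t ∷ p) ⟩
      linear W (restrict (_≟ m₀) (t ∷ p)) + linear W (restrict (λ m → ¬? (m ≟ m₀)) (t ∷ p))
        ≈⟨ +-cong (trans (linear-restrict-≡ W (t ∷ p) m₀) (vanish m₀)) (rec rest) ⟩
      0# + 0#
        ≈⟨ +-identityˡ 0# ⟩
      0# ∎
      where
      -- Removing the terms at `m₀` makes that coefficient zero and leaves every other one
      -- unchanged, so the hypothesis passes to the remainder.
      rest : ∀ m → coeff (restrict (λ m → ¬? (m ≟ m₀)) (t ∷ p)) m * W m ≈ 0#
      rest m = trans (*-congʳ (coeff-restrict (λ m → ¬? (m ≟ m₀)) (t ∷ p) m)) (cases m)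
        where
        cases : ∀ m → (if does (¬? (m ≟ m₀)) then coeff (t ∷ p) m else 0#) * W m ≈ 0#
        cases m with does (m ≟ m₀)
        ... | true  = zeroˡ _
        ... | false = vanish m

  linear-≈[] : ∀ {n} W (p : Poly n) → p ≈ₚ [] → linear W p ≈ 0#
  linear-≈[] W p p≈[] = linear-zero W p λ m → trans (*-congʳ (p≈[] m)) (zeroˡ _)

  -- The difference of the two formal sums has only zero coefficients, so `linear-≈[]` applies to
  -- it. Thus `linear W` is well defined on polynomials and not only on their representations.
  linear-resp : ∀ {n} W (p r : Poly n) → p ≈ₚ r → linear W p ≈ linear W r
  linear-resp W p r p≈r = x∙y⁻¹≈ε⇒x≈y _ _ $ begin
    linear W p - linear W r       ≈⟨ +-congˡ (linear-neg W r) ⟨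
    linear W p + linear W -r      ≈⟨ linear-++ W p -r ⟨
    linear W (p ++ -r)            ≈⟨ linear-≈[] W (p ++ -r) p-r≈[] ⟩
    0#                            ∎
    where
    open GroupProperties +-group using (x∙y⁻¹≈ε⇒x≈y)
    -r = List.map (Product.map₁ (-_)) r
    p-r≈[] : p ++ -r ≈ₚ []
    p-r≈[] m = begin
      coeff (p ++ -r) m          ≈⟨ coeff-++ p -r m ⟩
      coeff p m + coeff -r m     ≈⟨ +-cong (p≈r m) (coeff-neg r m) ⟩
      coeff r m - coeff r m      ≈⟨ -‿inverseʳ _ ⟩
      0#                         ∎

  -- For `g = push h` this is the algebra map sending the variable `e` to the variable `h e`. Unlike
  -- `substitute` it leaves coefficients syntactically alone, so several of its laws hold up to `≡`.
  mapMonomials : ∀ {n p} → (Vec ℕ n → Vec ℕ p) → Poly n → Poly p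
  mapMonomials g = List.map (Product.map₂ g)

  linear-mapMonomials : ∀ {n p} W (g : Vec ℕ n → Vec ℕ p) f →
                        linear W (mapMonomials g f) ≡ linear (W ∘ g) f
  linear-mapMonomials W g []            = refl
  linear-mapMonomials W g ((a , m) ∷ f) =
    ≡.cong (a * W (g m) +_) (linear-mapMonomials W g f)

  coeff-mapMonomials : ∀ {n p} (g : Vec ℕ n → Vec ℕ p) f m →
                       coeff (mapMonomials g f) m ≈ linear (δ m ∘ g) f
  coeff-mapMonomials g f m = trans (coeff≈linear (mapMonomials g f) m)
    (reflexive (linear-mapMonomials (δ m) g f))

  mapMonomials-resp : ∀ {n p} (g : Vec ℕ n → Vec ℕ p) f f′ → f ≈ₚ f′ →
                      mapMonomials g f ≈ₚ mapMonomials g f′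
  mapMonomials-resp g f f′ f≈f′ m = begin
    coeff (mapMonomials g f) m     ≈⟨ coeff-mapMonomials g f m ⟩
    linear (δ m ∘ g) f             ≈⟨ linear-resp (δ m ∘ g) f f′ f≈f′ ⟩
    linear (δ m ∘ g) f′            ≈⟨ coeff-mapMonomials g f′ m ⟨
    coeff (mapMonomials g f′) m    ∎

  mapMonomials-* : ∀ {n p} (g : Vec ℕ n → Vec ℕ p) →
    (∀ u v → g (Vec.zipWith ℕ._+_ u v) ≡ Vec.zipWith ℕ._+_ (g u) (g v)) →
    ∀ f f′ → mapMonomials g (List.cartesianProductWith mulTerm f f′) ≡
             List.cartesianProductWith mulTerm (mapMonomials g f) (mapMonomials g f′)
  mapMonomials-* g g-+ []      f′ = refl
  mapMonomials-* g g-+ (t ∷ f) f′ = ≡.trans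
    (List.map-++ _ (List.map (mulTerm t) f′) _)
    (≡.cong₂ _++_ (mulTerm-map f′) (mapMonomials-* g g-+ f f′))
    where
    mulTerm-map : ∀ f′ → mapMonomials g (List.map (mulTerm t) f′) ≡
                         List.map (mulTerm (Product.map₂ g t)) (mapMonomials g f′)
    mulTerm-map []       = refl
    mulTerm-map (u ∷ f′) = ≡.cong₂ _∷_
      (≡.cong (proj₁ t * proj₁ u ,_) (g-+ (proj₂ t) (proj₂ u))) (mulTerm-map f′)

  -- Meant for tests on the degree, which `push` preserves: selecting degrees then commutes with
  -- collapsing each block to one variable, so the kernel of `θ` is graded.
  mapMonomials-restrict : ∀ {n p r q} {P : Pred (Vec ℕ n) r} {Q : Pred (Vec ℕ p) q}
    (P? : Decidable₁ P) (Q? : Decidable₁ Q) (g : Vec ℕ n → Vec ℕ p) →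
    (∀ m → does (P? m) ≡ does (Q? (g m))) →
    ∀ f → mapMonomials g (restrict P? f) ≡ restrict Q? (mapMonomials g f)
  mapMonomials-restrict P? Q? g P≡Q []            = refl
  mapMonomials-restrict P? Q? g P≡Q ((a , m) ∷ f)
    with does (P? m) | does (Q? (g m)) | P≡Q m
  ... | true  | .true  | refl = ≡.cong (_ ∷_) (mapMonomials-restrict P? Q? g P≡Q f)
  ... | false | .false | refl = mapMonomials-restrict P? Q? g P≡Q f

  restrict-≈[] : ∀ {n r} {P : Pred (Vec ℕ n) r} (P? : Decidable₁ P) p →
                 p ≈ₚ [] → restrict P? p ≈ₚ []
  restrict-≈[] P? p p≈[] m = trans (coeff-restrict P? p m) (cases (does (P? m)))
    where
    cases : ∀ b → (if b then coeff p m else 0#) ≈ 0#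
    cases true  = p≈[] m
    cases false = ≈-refl

  -- Evaluation and homogeneity.

  open ExtensionProperties *-commutativeMonoid using (extend; extend-cong)

  eval≡linear : ∀ {n} (x : Vector Carrier n) p → eval x p ≡ linear (extend x) p
  eval≡linear x []            = refl
  eval≡linear x ((a , m) ∷ p) = ≡.cong (a * extend x m +_) (eval≡linear x p)

  eval-cong : ∀ {n} {x y : Vector Carrier n} → (∀ e → x e ≈ y e) →
              ∀ p → eval x p ≈ eval y p
  eval-cong {x = x} {y} x≈y p = begin
    eval x p               ≡⟨ eval≡linear x p ⟩
    linear (extend x) p    ≈⟨ linear-cong (extend-cong x≈y) p ⟩
    linear (extend y) p    ≡⟨ eval≡linear y p ⟨
    eval y p               ∎

  eval-≈[] : ∀ {n} (x : Vector Carrier n) p → p ≈ₚ [] → eval x p ≈ 0#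
  eval-≈[] x p p≈[] = trans (reflexive (eval≡linear x p)) (linear-≈[] (extend x) p p≈[])

  -- On monomials this is `extend-push` for the multiplicative monoid of the field. It trades a
  -- relabelled polynomial for a point with relabelled coordinates, which drives both vanishing
  -- arguments below.
  eval-push : ∀ {n p} (x : Vector Carrier n) (h : Fin p → Fin n) f →
              eval x (mapMonomials (push h) f) ≈ eval (x ∘ h) f
  eval-push x h f = begin
    eval x (mapMonomials (push h) f)                ≡⟨ eval≡linear x (mapMonomials (push h) f) ⟩
    linear (extend x) (mapMonomials (push h) f)     ≡⟨ linear-mapMonomials (extend x) (push h) f ⟩
    linear (extend x ∘ push h) f                    ≈⟨ linear-cong (extend-push *-commutativeMonoid x h) f ⟩
    linear (extend (x ∘ h)) f                       ≡⟨ eval≡linear (x ∘ h) f ⟨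
    eval (x ∘ h) f                                  ∎

  restrict-homogeneous : ∀ {n} d (f : Poly n) →
                         IsHomogeneous (restrict (λ m → Vec.sum m ℕ.≟ d) f)
  restrict-homogeneous d f = d , λ m c≉0 → selected (Vec.sum m ℕ.≟ d) λ c≈0 →
    c≉0 (trans (coeff-restrict (λ m → Vec.sum m ℕ.≟ d) f m) c≈0)
    where
    selected : ∀ {p} {P : Set p} (P? : Dec P) {x} →
               (if does P? then x else 0#) ≉ 0# → P
    selected (yes p) _   = p
    selected (no _)  0≉0 = contradiction ≈-refl 0≉0

  -- Several monomials may be sent to the same `m`, and their coefficients add up. If `m` has degree
  -- other than `d`, so has each of them, and each coefficient is then zero. Homogeneity only speaks
  -- of nonzero coefficients, so concluding that one is zero uses the decision of `≈`.
  push-homogeneous : Decidable _≈_ → ∀ {n p} (h : Fin p → Fin n) f →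
    IsHomogeneous f → IsHomogeneous (mapMonomials (push h) f)
  push-homogeneous _≈?_ h f (d , hom) = d , λ m c≉0 →
    decidable-stable (Vec.sum m ℕ.≟ d) λ m≢d →
    c≉0 (trans (coeff-mapMonomials (push h) f m)
               (linear-zero (δ m ∘ push h) f (term≈0 m m≢d)))
    where
    term≈0 : ∀ m → ¬ Vec.sum m ≡ d → ∀ m′ → coeff f m′ * δ m (push h m′) ≈ 0#
    term≈0 m m≢d m′ with Vec.≡-dec ℕ._≟_ (push h m′) m
    ... | no  _    = zeroʳ _
    ... | yes refl with coeff f m′ ≈? 0#
    ...   | yes c≈0 = trans (*-congʳ c≈0) (zeroˡ _)
    ...   | no  c≉0 = contradiction (≡.trans (sum-push h m′) (hom m′ c≉0)) m≢d

  -- Substituting variables for variables.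

  -- Coefficients are compared with ≈ because substitute produces products
  -- such as 1# * 1#.
  IsTerm : ∀ {n} → Poly n → Carrier → Vec ℕ n → Set _
  IsTerm p a m = ∃[ c ] c ≈ a Product.× p ≡ (c , m) ∷ []

  term-++ : ∀ {n} {p : Poly n} {a m} r r′ → IsTerm p a m → r ≈ₚ r′ →
            p ++ r ≈ₚ (a , m) ∷ r′
  term-++ {m = m} _ _ (c , c≈a , refl) r≈r′ m′ with does (Vec.≡-dec ℕ._≟_ m m′)
  ... | true  = +-cong c≈a (r≈r′ m′)
  ... | false = +-congˡ (r≈r′ m′)

  module _ {n : ℕ} where
    open RawRing (polyRing n) using () renaming (_*_ to _*ₚ_; rawSemiring to polySemiring)
    open RawSemiringDefinitions polySemiring using (product) renaming (_^_ to _^ₚ_)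
    private module E = CommutativeMonoidMult (exponents n)

    *-term : ∀ {p r : Poly n} {a b u v} → IsTerm p a u → IsTerm r b v →
             IsTerm (p *ₚ r) (a * b) (Vec.zipWith ℕ._+_ u v)
    *-term (c , c≈a , refl) (c′ , c′≈b , refl) = c * c′ , *-cong c≈a c′≈b , refl

    monic-* : ∀ {p r : Poly n} {u v} → IsTerm p 1# u → IsTerm r 1# v →
              IsTerm (p *ₚ r) 1# (Vec.zipWith ℕ._+_ u v)
    monic-* p≡u r≡v =
      Product.map₂ (Product.map₁ λ c≈ → trans c≈ (*-identityˡ 1#)) (*-term p≡u r≡v)

    monic-^ : ∀ {p : Poly n} {u} → IsTerm p 1# u → ∀ r → IsTerm (p ^ₚ r) 1# (r E.× u)
    monic-^ p≡u ℕ.zero    = 1# , ≈-refl , refl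
    monic-^ p≡u (ℕ.suc r) = monic-* p≡u (monic-^ p≡u r)

    monic-product : ∀ {p} (h : Fin p → Fin n) m →
      IsTerm (product (λ e → var (h e) ^ₚ Vec.lookup m e)) 1# (push h m)
    monic-product h []      = 1# , ≈-refl , refl
    monic-product h (r ∷ m) =
      monic-* (monic-^ (1# , ≈-refl , refl) r) (monic-product (h ∘ suc) m)

    -- Each product of powers of variables is a single term with coefficient 1 and exponent
    -- `push h m`. From here on `θ` can be computed on exponents.
    substitute-var : ∀ {p} (h : Fin p → Fin n) (f : Poly p) →
      substitute (polyRing n) constₚ (var ∘ h) f ≈ₚ mapMonomials (push h) f
    substitute-var h []            = λ _ → ≈-refl
    substitute-var h ((a , m) ∷ f) = term-++ _ (mapMonomials (push h) f) term (substitute-var h f)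
      where
      term : IsTerm (constₚ a *ₚ product (λ e → var (h e) ^ₚ Vec.lookup m e)) a (push h m)
      term = let (c , c≈ , eq) = *-term (a , ≈-refl , refl) (monic-product h m) in
        c , trans c≈ (*-identityʳ a) ,
        -- The constant factor contributes the zero exponent vector.
        ≡.trans eq (≡.cong (λ v → (c , v) ∷ []) (Vec.zipWith-identityˡ ℕ.+-identityˡ (push h m)))

-- Positions of the edges in their blocks.

locate-surjective : ∀ {k} (n : Vector ℕ k) i j → ∃[ e ] locate n e ≡ (i , j)
locate-surjective {ℕ.suc k} n zero    j = j ↑ˡ _ , eq
  where
  eq : locate n (j ↑ˡ _) ≡ (zero , j)
  eq rewrite Fin.splitAt-↑ˡ (n zero) j (sum (Vector.tail n)) = refl
locate-surjective {ℕ.suc k} n (suc i) j =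
  let (e , eq) = locate-surjective (Vector.tail n) i j in
  n zero ↑ʳ e , step e eq
  where
  step : ∀ e → locate (Vector.tail n) e ≡ (i , j) → locate n (n zero ↑ʳ e) ≡ (suc i , j)
  step e eq rewrite Fin.splitAt-↑ʳ (n zero) (sum (Vector.tail n)) e | eq = refl

module LabelledGraphProperties {k : ℕ} (𝒢 : LabelledGraph k) where
  open LabelledGraph 𝒢

  matchingEdge-position : ∀ i → ∃[ j ] nbr i j ≡ even i
  matchingEdge-position i = nbr-surjective i (proj₁ matching i)

  -- The variable of this edge represents the whole block in the section of `θ`.
  matchingEdge : Fin k → Fin s
  matchingEdge i =
    proj₁ (locate-surjective oddDegree i (proj₁ (matchingEdge-position i)))

  private
    locate-matchingEdge : ∀ i →
      locate oddDegree (matchingEdge i) ≡ (i , proj₁ (matchingEdge-position i))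
    locate-matchingEdge i =
      proj₂ (locate-surjective oddDegree i (proj₁ (matchingEdge-position i)))

  block-matchingEdge : ∀ i → block (matchingEdge i) ≡ i
  block-matchingEdge i = ≡.cong proj₁ (locate-matchingEdge i)

  edge-matchingEdge : ∀ i → edge (matchingEdge i) ≡ (odd i , even i)
  edge-matchingEdge i rewrite locate-matchingEdge i =
    ≡.cong (odd i ,_) (proj₂ (matchingEdge-position i))

  nbr-even : ∀ i j → ∃[ l ] nbr i j ≡ even l
  nbr-even i j with bipartite (nbr-adjacent i j)
  ... | inj₁ (_ , l , _ , nbr≡even)   = l , nbr≡even
  -- The second argument of `combine` is the parity, so an odd vertex cannot equal an even one.
  ... | inj₂ (l , _ , odd≡even , _) =
    contradiction (Fin.combine-injectiveʳ i zero l (suc zero) odd≡even) λ ()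

-- Arithmetic in a finite field.

module FieldProperties {c ℓ} (K : FiniteField c ℓ) where
  open FiniteField K

  -- Finiteness enters here, through comparison of indices in `Fin q`; the result serves to separate
  -- zero from nonzero coefficients.
  _≈?_ : Decidable _≈_
  _≈?_ = via-injection (Inverse⇒Injection finite) Fin._≟_

  *-nonzero : ∀ {x y} → x ≉ 0# → y ≉ 0# → x * y ≉ 0#
  *-nonzero {x} {y} x≉0 y≉0 xy≈0 = y≉0 $ begin
    y                ≈⟨ *-identityˡ y ⟨
    1# * y           ≈⟨ *-congʳ (proj₂ (inverse x x≉0)) ⟨
    x * x⁻¹ * y      ≈⟨ xy∙z≈xz∙y x x⁻¹ y ⟩
    x * y * x⁻¹      ≈⟨ *-congʳ xy≈0 ⟩
    0# * x⁻¹         ≈⟨ zeroˡ x⁻¹ ⟩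
    0#               ∎
    where
    x⁻¹ = proj₁ (inverse x x≉0)
    open SetoidReasoning setoid
    open CommutativeSemigroupProperties *-commutativeSemigroup using (xy∙z≈xz∙y)

-- The vanishing ideals of the two toric sets.

module ToricProperties {c ℓ} (K : FiniteField c ℓ) {k : ℕ} (𝒢 : LabelledGraph k) where
  open FiniteField K using (commutativeRing; 1≉0)
  open CommutativeRing commutativeRing hiding (refl; zero)
  open FieldProperties K
  open LabelledGraph 𝒢
  open LabelledGraphProperties 𝒢
  open Polynomials commutativeRing
  open PolynomialProperties commutativeRing
  open Projective commutativeRing
  open Ideals (polyRing s)
  open Toric commutativeRing 𝒢
  open SetoidReasoning setoid

  𝕐⊆𝕏 : 𝕐 ⊆ 𝕏
  𝕐⊆𝕏 (t , t≉0 , u , u≉0 , x≈ut) = t′ , t′≉0 , u , u≉0 , λ e →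
    trans (x≈ut e) (*-congˡ (sym (t′-edge e)))
    where
    pick : Fin k Product.× Fin 2 → Carrier
    pick (i , zero)  = t i
    pick (i , suc _) = 1#
    t′ : Vector Carrier (k ℕ.* 2)
    -- `remQuot 2` inverts `combine`, recovering the index and the parity of a vertex.
    t′ v = pick (remQuot 2 v)
    t′≉0 : ∀ v → t′ v ≉ 0#
    t′≉0 v with remQuot {k} 2 v
    ... | i , zero  = t≉0 i
    ... | i , suc _ = 1≉0
    -- The far end of every edge is an even vertex, where the parameter is `1#`; the near end is the
    -- odd vertex of the block.
    t′-edge : ∀ e → t′ (proj₁ (edge e)) * t′ (proj₂ (edge e)) ≈ t (block e)
    t′-edge e with locate oddDegree e
    ... | i , j with nbr i j | nbr-even i j
    ...   | _ | l , refl
      rewrite Fin.remQuot-combine {k} {2} i zero | Fin.remQuot-combine {k} {2} l (suc zero)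
      = *-identityʳ (t i)

  I𝕏⊆I𝕐 : VanishingIdeal 𝕏 ⊆ VanishingIdeal 𝕐
  I𝕏⊆I𝕐 (gen (hom , vanish)) = gen (hom , λ P P∈𝕐 → vanish P (𝕐⊆𝕏 {P} P∈𝕐))
  I𝕏⊆I𝕐 zero        = zero
  I𝕏⊆I𝕐 (add p r)   = add (I𝕏⊆I𝕐 p) (I𝕏⊆I𝕐 r)
  I𝕏⊆I𝕐 (mul r p)   = mul r (I𝕏⊆I𝕐 p)
  I𝕏⊆I𝕐 (resp eq p) = resp eq (I𝕏⊆I𝕐 p)

  -- The generators of the ideal are forms, so an element of the kernel is first cut into its
  -- homogeneous parts. Since `push block` preserves degree, each part collapses to zero by itself.
  kerθ⊆I𝕐 : kerθ ⊆ VanishingIdeal 𝕐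
  kerθ⊆I𝕐 {f} θf≈[] = filter-induction ℕ._≟_ (Vec.sum ∘ proj₂)
      (λ p → collapse p ≈ₚ [] → VanishingIdeal 𝕐 p) (λ _ → zero) step f
      (λ m → trans (sym (substitute-var block f m)) (θf≈[] m))
    where
    collapse : Poly s → Poly k
    collapse = mapMonomials (push block)

    collapse-restrict : ∀ {r} {P : Pred ℕ r} (P? : Decidable₁ P) p → collapse p ≈ₚ [] →
                        collapse (restrict (P? ∘ Vec.sum) p) ≈ₚ []
    collapse-restrict P? p eq = ≡.subst (_≈ₚ [])
      (≡.sym (mapMonomials-restrict (P? ∘ Vec.sum) (P? ∘ Vec.sum) (push block)
        (λ m → ≡.cong (does ∘ P?) (≡.sym (sum-push block m))) p))
      (restrict-≈[] (P? ∘ Vec.sum) (collapse p) eq)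

    -- Coordinates of a point of `𝕐`, scalar included, factor through `block`, so evaluation there
    -- factors through `collapse`.
    vanishes : ∀ p → collapse p ≈ₚ [] → VanishesOn p 𝕐
    vanishes p eq P (t , _ , u , _ , x≈ut) = begin
      eval (Point.coords P) p                ≈⟨ eval-cong x≈ut p ⟩
      eval ((λ i → u * t i) ∘ block) p       ≈⟨ eval-push (λ i → u * t i) block p ⟨
      eval (λ i → u * t i) (collapse p)      ≈⟨ eval-≈[] _ (collapse p) eq ⟩
      0#                                     ∎

    step : ∀ t p →
      (collapse (restrict (λ m → ¬? (Vec.sum m ℕ.≟ Vec.sum (proj₂ t))) (t ∷ p)) ≈ₚ [] →
       VanishingIdeal 𝕐 (restrict (λ m → ¬? (Vec.sum m ℕ.≟ Vec.sum (proj₂ t))) (t ∷ p))) →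
      collapse (t ∷ p) ≈ₚ [] → VanishingIdeal 𝕐 (t ∷ p)
    -- The part in the degree of the head is a generator; the remaining degrees are left to the
    -- induction.
    step t p rec eq = resp (λ m → sym (≈ₚ-split (λ m → Vec.sum m ℕ.≟ d) (t ∷ p) m)) $ add
        (gen {x = form} ( restrict-homogeneous d (t ∷ p)
                        , vanishes form (collapse-restrict (ℕ._≟ d) (t ∷ p) eq)))
        (rec (collapse-restrict (λ e → ¬? (e ℕ.≟ d)) (t ∷ p) eq))
      where
      d    = Vec.sum (proj₂ t)
      form = restrict (λ m → Vec.sum m ℕ.≟ d) (t ∷ p)

  -- θ followed by its section Y₂ᵢ₋₁ ↦ the variable of the edge {v₂ᵢ₋₁, v₂ᵢ}.
  retract : Poly s → Poly s
  retract = mapMonomials (push (matchingEdge ∘ block))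

  -- The value of `retract f` at `P` is that of `f` at `P′`, obtained from `P` by spreading the
  -- coordinate of each matching edge over its block. This `P′` lies in `𝕐` with the same scalar
  -- `u`.
  retract-vanishes : ∀ f → VanishesOn f 𝕐 → VanishesOn (retract f) 𝕏
  retract-vanishes f vanish P (t , t≉0 , u , u≉0 , x≈utt) = trans
    (eval-push x (matchingEdge ∘ block) f)
    (vanish P′ (y , (λ i → *-nonzero (t≉0 (odd i)) (t≉0 (even i))) , u , u≉0 , x∘≈uy))
    where
    x = Point.coords P
    -- Every coordinate of `P′` is nonzero, so any position serves as witness; `P` supplies one.
    e = proj₁ (Point.nonzero P)
    y : Vector Carrier k
    y i = t (odd i) * t (even i)
    x∘≈uy : ∀ e → x (matchingEdge (block e)) ≈ u * y (block e)
    x∘≈uy e = trans (x≈utt (matchingEdge (block e)))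
      (reflexive (≡.cong (λ (v , w) → u * (t v * t w)) (edge-matchingEdge (block e))))
    P′ : Point s
    P′ = record
      { coords  = x ∘ matchingEdge ∘ block
      ; nonzero = e , λ x≈0 →
          let i = block e in
          *-nonzero u≉0 (*-nonzero (t≉0 (odd i)) (t≉0 (even i)))
            (trans (sym (x∘≈uy e)) x≈0)
      }

  -- `retract` respects sums, products and `≈ₚ`, so the claim reduces to generators, where
  -- `push-homogeneous` and `retract-vanishes` apply.
  retract-I𝕏 : ∀ {f} → VanishingIdeal 𝕐 f → VanishingIdeal 𝕏 (retract f)
  retract-I𝕏 (gen {f} (hom , vanish)) =
    gen (push-homogeneous _≈?_ (matchingEdge ∘ block) f hom , retract-vanishes f vanish)
  retract-I𝕏 zero            = zero
  retract-I𝕏 (add {f} {g} p r) =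
    ≡.subst (VanishingIdeal 𝕏) (≡.sym (List.map-++ _ f g)) (add (retract-I𝕏 p) (retract-I𝕏 r))
  retract-I𝕏 (mul r {f} p)   =
    ≡.subst (VanishingIdeal 𝕏)
      (≡.sym (mapMonomials-* (push (matchingEdge ∘ block)) (push-+ _) r f))
      (mul (retract r) (retract-I𝕏 p))
  retract-I𝕏 (resp {f} {g} eq p) = resp (mapMonomials-resp _ f g eq) (retract-I𝕏 p)

  -- The matching edge of a block lies in that block; on exponents this says that applying `θ` after
  -- `retract` is the same as applying `θ`.
  push-block-retract : ∀ m → push block (push (matchingEdge ∘ block) m) ≡ push block m
  push-block-retract m = ≡.trans (push-∘ block (matchingEdge ∘ block) m)
    (push-cong (λ e → block-matchingEdge (block e)) m)

  -ₚ_ : Poly s → Poly s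
  -ₚ_ = RawRing.-_ (polyRing s)

  f-retract∈kerθ : ∀ f → kerθ (f ++ -ₚ retract f)
  f-retract∈kerθ f m = begin
    coeff (θ (f ++ -ₚ retract f)) m                        ≈⟨ substitute-var block (f ++ -ₚ retract f) m ⟩
    coeff (mapMonomials (push block) (f ++ -ₚ retract f)) m
                                                           ≈⟨ coeff-mapMonomials (push block) (f ++ -ₚ retract f) m ⟩
    linear W (f ++ -ₚ retract f)                           ≈⟨ linear-++ W f _ ⟩
    linear W f + linear W (-ₚ retract f)                   ≈⟨ +-congˡ (linear-neg W (retract f)) ⟩
    linear W f - linear W (retract f)                      ≈⟨ +-congˡ (-‿cong W-retract) ⟩
    linear W f - linear W f                                ≈⟨ -‿inverseʳ _ ⟩
    0#                                                     ∎
    where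
    -- With this weight `linear W` reads off the coefficient of `m` in the image under `θ`.
    W = δ m ∘ push block
    W-retract : linear W (retract f) ≈ linear W f
    W-retract = trans (reflexive (linear-mapMonomials W (push (matchingEdge ∘ block)) f))
      (linear-cong (λ m′ → reflexive (≡.cong (δ m) (push-block-retract m′))) f)

  f≈retract+rest : ∀ f → f ≈ₚ retract f ++ (f ++ -ₚ retract f)
  f≈retract+rest f m = begin
    coeff f m                                           ≈⟨ +-identityʳ _ ⟨
    coeff f m + 0#                                      ≈⟨ +-congˡ (-‿inverseʳ _) ⟨
    coeff f m + (coeff g m - coeff g m)                 ≈⟨ x∙yz≈y∙xz _ _ _ ⟩
    coeff g m + (coeff f m - coeff g m)                 ≈⟨ +-congˡ (+-congˡ (coeff-neg g m)) ⟨
    coeff g m + (coeff f m + coeff (-ₚ g) m)            ≈⟨ +-congˡ (coeff-++ f (-ₚ g) m) ⟨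
    coeff g m + coeff (f ++ -ₚ g) m                     ≈⟨ coeff-++ g (f ++ -ₚ g) m ⟨
    coeff (g ++ (f ++ -ₚ g)) m                          ∎
    where
    g = retract f
    open CommutativeSemigroupProperties +-commutativeSemigroup using (x∙yz≈y∙xz)

proposition4p3 :
    ∀ {c ℓ} (K : FiniteField c ℓ) (k : ℕ) .{{_ : NonZero k}} (𝒢 : LabelledGraph k) →
    let open FiniteField K using (commutativeRing)
        open LabelledGraph 𝒢 using (s)
        open Polynomials commutativeRing
        open Projective commutativeRing
        open Ideals (polyRing s)
        open Toric commutativeRing 𝒢
    in (f : Poly s) → VanishingIdeal 𝕐 f ⇔ (VanishingIdeal 𝕏 ⊕ kerθ) f
proposition4p3 K k 𝒢 f = mk⇔
  (λ f∈I𝕐 → retract f , _ , retract-I𝕏 f∈I𝕐 , f-retract∈kerθ f , f≈retract+rest f)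
  (λ (x , y , x∈I𝕏 , y∈kerθ , f≈x+y) →
    resp (λ m → sym (f≈x+y m)) (add (I𝕏⊆I𝕐 x∈I𝕏) (kerθ⊆I𝕐 y∈kerθ)))
  where
  open FiniteField K using (sym; commutativeRing)
  open LabelledGraph 𝒢 using (s)
  open Polynomials commutativeRing using (polyRing)
  open Ideals (polyRing s)
  open ToricProperties K 𝒢
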